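{- Let $T$ be a tree of diameter $d$ and let $D$ be a target distribution on $T$ of size $t\ge 1$. Then $\pi(T,D)\le \pi_t(T)-s(D)+1$. Furthermore, if $C$ is a configuration on $T$ of size $|C|\ge \pi_t(T)-s(D)+1$, then for every vertex $v$ with $D(v)>0$, $C$ solves $v$ with cost at most $2^{\mathrm{ecc}_T(v)}$.
   Context: A configuration on a connected graph $G$ is a function $C:V(G)\to\mathbb{N}$ (number of pebbles on each vertex), of size $|C|=\sum_v C(v)$. A pebbling step from a vertex $u$ with $C(u)\ge 2$ to a neighbor $w$ removes two pebbles from $u$ and adds one pebble to $w$. For a vertex $r$, $C$ is $t$-fold $r$-solvable if some sequence of pebbling steps places at least $t$ pebbles on $r$; $\pi_t(G,r)$ is the least $m$ such that every configuration of size $m$ is $t$-fold $r$-solvable, and $\pi_t(G)=\max_r \pi_t(G,r)$. A target distribution is a function $D:V(G)\to\mathbb{N}$, of size $|D|=\sum_v D(v)$; $C$ is $D$-solvable if some sequence of pebbling steps results in at least $D(v)$ pebbles on each vertex $v$ simultaneously, and $\pi(G,D)$ is the least $m$ such that every configuration of size at least $m$ is $D$-solvable. $s(D)$ denotes the number of vertices $v$ with $D(v)>0$. For an $r$-solution $\sigma$ (a sequence of $c$ pebbling steps placing a pebble on $r$), its cost is $c+1$; "$C$ solves $v$ with cost at most $x$" means there is a sequence of pebbling steps from $C$ placing a pebble on $v$ whose cost is at most $x$. $\mathrm{ecc}_T(v)$ is the maximum distance in $T$ from $v$ to another vertex. -}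

module Defs where

open import Data.Nat using (ℕ; zero; suc; _+_; _≤_; _<_)
open import Data.Fin using (Fin; _≟_)
import Data.Fin as Fin
open import Data.List using (List; []; _∷_; _++_; [_]; length)
open import Data.List.Relation.Unary.Unique.Propositional using (Unique)
open import Data.Product using (Σ; ∃; _×_; _,_)
open import Data.Bool using (if_then_else_)
open import Relation.Nullary using (¬_; does)
open import Relation.Binary.PropositionalEquality using (_≡_)
open import Data.Nat using (_∸_)

record Graph (n : ℕ) : Set₁ where
  field
    E       : Fin n → Fin n → Set
    E-sym   : ∀ {u w} → E u w → E w u
    E-irrefl : ∀ {u} → ¬ E u u
open Graph public

module _ {n : ℕ} (G : Graph n) where

  data Walk : Fin n → Fin n → ℕ → Set where
    here : ∀ {u} → Walk u u 0
    step : ∀ {u x w k} → E G u x → Walk x w k → Walk u w (suc k)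

  Connected : Set
  Connected = ∀ u w → ∃ λ k → Walk u w k

  data Chain : List (Fin n) → Set where
    []  : Chain []
    [-] : ∀ {x} → Chain (x ∷ [])
    _∷_ : ∀ {x y ys} → E G x y → Chain (y ∷ ys) → Chain (x ∷ y ∷ ys)

  Cycle : Set
  Cycle = Σ (Fin n) λ x → Σ (List (Fin n)) λ xs →
            2 ≤ length xs × Unique (x ∷ xs) × Chain (x ∷ xs ++ [ x ])

  Acyclic : Set
  Acyclic = ¬ Cycle

  IsTree : Set
  IsTree = Connected × Acyclic

  IsDist : Fin n → Fin n → ℕ → Set
  IsDist u w k = Walk u w k × (∀ k' → Walk u w k' → k ≤ k')

  IsEcc : Fin n → ℕ → Set
  IsEcc v e = (∀ w k → IsDist v w k → k ≤ e) × (∃ λ w → IsDist v w e)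

Config : ℕ → Set
Config n = Fin n → ℕ

size : ∀ {n} → Config n → ℕ
size {zero}  C = 0
size {suc n} C = C Fin.zero + size (λ i → C (Fin.suc i))

support : ∀ {n} → Config n → ℕ
support {zero}  D = 0
support {suc n} D with D Fin.zero
... | zero  = support (λ i → D (Fin.suc i))
... | suc _ = suc (support (λ i → D (Fin.suc i)))

-- result of a pebbling step from u to w (u ≠ w)
move : ∀ {n} → Fin n → Fin n → Config n → Config n
move u w C x =
  if does (x ≟ u) then C x ∸ 2
  else if does (x ≟ w) then suc (C x) else C x

module _ {n : ℕ} (G : Graph n) where

  data Steps : Config n → Config n → ℕ → Set where
    done : ∀ {C} → Steps C C 0
    step : ∀ {C C' c u w} → E G u w → 2 ≤ C u →
           Steps (move u w C) C' c → Steps C C' (suc c)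

  Solvable : ℕ → Fin n → Config n → Set
  Solvable t r C = ∃ λ C' → ∃ λ c → Steps C C' c × t ≤ C' r

  DSolvable : Config n → Config n → Set
  DSolvable D C = ∃ λ C' → ∃ λ c → Steps C C' c × (∀ v → D v ≤ C' v)

  -- C solves v with cost at most x (cost of c steps is c + 1)
  SolvesWithCost : Config n → Fin n → ℕ → Set
  SolvesWithCost C v x =
    ∃ λ C' → ∃ λ c → Steps C C' c × 1 ≤ C' v × suc c ≤ x

  IsPiRoot : ℕ → Fin n → ℕ → Set
  IsPiRoot t r m =
    (∀ C → size C ≡ m → Solvable t r C) ×
    (∀ m' → (∀ C → size C ≡ m' → Solvable t r C) → m ≤ m')

  IsPi : ℕ → ℕ → Set
  IsPi t m =
    (∀ r mr → IsPiRoot t r mr → mr ≤ m) × (∃ λ r → IsPiRoot t r m)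

  IsPiD : Config n → ℕ → Set
  IsPiD D m =
    (∀ C → m ≤ size C → DSolvable D C) ×
    (∀ m' → (∀ C → m' ≤ size C → DSolvable D C) → m ≤ m')

module Submission where

open import Defs
open import Data.Nat using (ℕ; _+_; _∸_; _≤_; _<_; _^_)
open import Data.Fin using (Fin)
open import Data.Product using (_×_)
open import Relation.Binary.PropositionalEquality using (_≡_)
import Algebra.Properties.CommutativeSemigroup as CommutativeSemigroupProperties
open import Data.Bool using (Bool; true; false; if_then_else_)
open import Data.Empty using (⊥; ⊥-elim)
open import Data.Fin using (zero; suc; _≟_)
open import Data.List using (List; []; _∷_; _++_; [_]; allFin)
import Data.List.Membership.DecPropositional as DecMembership
open import Data.List.Membership.Propositional using (_∈_; _∉_)
open import Data.List.Membership.Propositional.Properties using (∈-allFin)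
open import Data.List.Relation.Unary.All using ([]; _∷_)
open import Data.List.Relation.Unary.All.Properties using (¬Any⇒All¬)
open import Data.List.Relation.Unary.AllPairs using ([]; _∷_)
open import Data.List.Relation.Unary.Any using (here; there)
open import Data.List.Relation.Unary.Unique.Propositional using (Unique)
open import Data.Nat using (zero; suc; _*_; _⊔_; ⌊_/2⌋; z≤n; s≤s; s≤s⁻¹; _≤?_)
open import Data.Nat.Properties hiding (_≟_)
open import Data.Nat.Tactic.RingSolver using (solve-∀)
open import Data.Product using (Σ; ∃; _,_; proj₁; proj₂)
open import Data.Sum using (_⊎_; inj₁; inj₂; [_,_]′; swap)
open import Relation.Binary.Construct.Closure.ReflexiveTransitive using (Star; ε; _◅_; _◅◅_; reverse)
open import Relation.Binary.PropositionalEquality hiding ([_]; J)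
open import Relation.Nullary using (yes; no; does)
open import Relation.Nullary.Decidable using (dec-true; dec-false)

open CommutativeSemigroupProperties +-commutativeSemigroup using (interchange; x∙yz≈y∙xz)

-- Root T at r and let h(x) be the height of the subtree at x. Moving pebbles greedily towards r
-- gathers val pebbles there, no step increases val, and rounding gives
-- |C| ≤ val · 2^h(r) + W with W = Σ_{x ≠ r} 2^h(x); this is sharp, so
-- π_t(T, r) = W + (t − 1) 2^h(r) + 1. The estimate improves by one for every empty leaf other than r.
-- A greedy solution uses only pebbles within distance ecc(v), each carrying weight at least 2^-ecc(v)
-- of a total of 1, hence costs at most 2^ecc(v).
--
-- The targets are solved in order of increasing eccentricity (plus one for inner vertices). The term
-- s(D) is paid for by a credit of one on every target still to be solved and on every empty leaf.
-- A target loses its credit only if it is an occupied leaf, which is solved at cost 1, or an inner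
-- vertex v; in that case moving the root away from v shows
-- π_t(T) ≥ W(v) + (t − 1) 2^(ecc(v) + 1) + 1, which leaves room for the lost credit.

-- Configurations as vectors, their sizes, and rounding arithmetic

infixl 6 _⊕_
infixl 7 _⊙_
infix 4 _≤ᶜ_

_⊕_ : ∀ {n} → Config n → Config n → Config n
(C ⊕ D) w = C w + D w

_⊙_ : ∀ {n} → ℕ → Config n → Config n
(k ⊙ C) w = k * C w

_≤ᶜ_ : ∀ {n} → Config n → Config n → Set
C ≤ᶜ D = ∀ w → C w ≤ D w

δ : ∀ {n} → Fin n → Config n
δ x w = if does (w ≟ x) then 1 else 0

δ-refl : ∀ {n} (x : Fin n) → δ x x ≡ 1
δ-refl x with x ≟ x
... | yes _ = refl
... | no x≢x = ⊥-elim (x≢x refl)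

δ-≢ : ∀ {n} {x w : Fin n} → w ≢ x → δ x w ≡ 0
δ-≢ {x = x} {w} w≢x with w ≟ x
... | yes w≡x = ⊥-elim (w≢x w≡x)
... | no _ = refl

1≤δ⇒≡ : ∀ {n} {x w : Fin n} → 1 ≤ δ x w → w ≡ x
1≤δ⇒≡ {x = x} {w} h with w ≟ x
... | yes w≡x = w≡x
1≤δ⇒≡ () | no _

δ≤1 : ∀ {n} (x w : Fin n) → δ x w ≤ 1
δ≤1 x w with w ≟ x
... | yes _ = ≤-refl
... | no _ = z≤n

size-mono : ∀ {n} {C D : Config n} → C ≤ᶜ D → size C ≤ size D
size-mono {zero} h = z≤n
size-mono {suc n} h = +-mono-≤ (h zero) (size-mono (λ w → h (suc w)))

size-cong : ∀ {n} {C D : Config n} → (∀ w → C w ≡ D w) → size C ≡ size D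
size-cong h = ≤-antisym (size-mono (λ w → ≤-reflexive (h w))) (size-mono (λ w → ≤-reflexive (sym (h w))))

size-⊕ : ∀ {n} (C D : Config n) → size (C ⊕ D) ≡ size C + size D
size-⊕ {zero} C D = refl
size-⊕ {suc n} C D = trans (cong (C zero + D zero +_) (size-⊕ (λ i → C (suc i)) (λ i → D (suc i))))
  (interchange (C zero) (D zero) _ _)

size-⊙ : ∀ {n} k (C : Config n) → size (k ⊙ C) ≡ k * size C
size-⊙ {zero} k C = sym (*-zeroʳ k)
size-⊙ {suc n} k C = trans (cong (k * C zero +_) (size-⊙ k (λ i → C (suc i))))
  (sym (*-distribˡ-+ k (C zero) _))

size-0 : ∀ n → size {n} (λ _ → 0) ≡ 0
size-0 zero = refl
size-0 (suc n) = size-0 n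

size-*δ : ∀ {n} (f : Config n) x → size (λ w → f w * δ x w) ≡ f x
size-*δ {suc n} f zero = trans (cong₂ _+_ (*-identityʳ (f zero))
    (trans (size-cong (λ w → *-zeroʳ (f (suc w)))) (size-0 n)))
  (+-identityʳ (f zero))
size-*δ {suc n} f (suc x) = trans (cong (_+ size (λ w → f (suc w) * δ x w)) (*-zeroʳ (f zero)))
  (size-*δ (λ i → f (suc i)) x)

size-δ : ∀ {n} (x : Fin n) → size (δ x) ≡ 1
size-δ x = trans (size-cong (λ w → sym (*-identityˡ (δ x w)))) (size-*δ (λ _ → 1) x)

size-k⊙δ : ∀ {n} k (x : Fin n) → size (k ⊙ δ x) ≡ k
size-k⊙δ k x = trans (size-⊙ k (δ x)) (trans (cong (k *_) (size-δ x)) (*-identityʳ k))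

≤size : ∀ {n} (C : Config n) v → C v ≤ size C
≤size C v = subst (_≤ size C) (size-*δ C v)
  (size-mono λ w → ≤-trans (*-monoʳ-≤ (C w) (δ≤1 v w)) (≤-reflexive (*-identityʳ (C w))))

-- `IsPiRoot` speaks of configurations of one exact size, so the lower bound on it has to cut a
-- large unsolvable configuration down to each smaller size.
shrink : ∀ {n} (C : Config n) m → m ≤ size C → ∃ λ D → D ≤ᶜ C × size D ≡ m
shrink {zero} C .zero z≤n = C , (λ ()) , refl
shrink {suc n} C m m≤ with m ≤? C zero
... | yes m≤C₀ = (λ { zero → m ; (suc _) → 0 }) , (λ { zero → m≤C₀ ; (suc _) → z≤n })
                 , trans (cong (m +_) (size-0 n)) (+-identityʳ m)
... | no m≰C₀ with shrink (λ i → C (suc i)) (m ∸ C zero) (m≤n+o⇒m∸n≤o m (C zero) m≤)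
...   | D , D≤ , eq = (λ { zero → C zero ; (suc i) → D i }) , (λ { zero → ≤-refl ; (suc i) → D≤ i })
                      , trans (cong (C zero +_) eq) (m+[n∸m]≡n (<⇒≤ (≰⇒> m≰C₀)))

support≤size : ∀ {n} (D J : Config n) → (∀ v → 1 ≤ D v → 1 ≤ J v) → support D ≤ size J
support≤size {zero} D J h = z≤n
support≤size {suc n} D J h with D zero in eq
... | zero = m≤n⇒m≤o+n (J zero) (support≤size _ _ (λ v → h (suc v)))
... | suc k = +-mono-≤ (h zero (subst (1 ≤_) (sym eq) (s≤s z≤n))) (support≤size _ _ (λ v → h (suc v)))

argmin : ∀ {n} (D e : Config n) → (∀ v → D v ≡ 0) ⊎ (∃ λ v → 1 ≤ D v × (∀ w → 1 ≤ D w → e v ≤ e w))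
argmin {zero} D e = inj₁ λ ()
argmin {suc n} D e with D zero in eq | argmin (λ i → D (suc i)) (λ i → e (suc i))
... | zero | inj₁ none = inj₁ λ { zero → eq ; (suc v) → none v }
... | zero | inj₂ (v , Dv , min) =
  inj₂ (suc v , Dv , λ { zero D0 → ⊥-elim (<⇒≢ D0 (sym eq)) ; (suc w) → min w })
... | suc k | inj₁ none = inj₂ (zero , subst (1 ≤_) (sym eq) (s≤s z≤n)
  , λ { zero _ → ≤-refl ; (suc w) Dw → ⊥-elim (<⇒≢ Dw (sym (none w))) })
... | suc k | inj₂ (v , Dv , min) with ≤-total (e zero) (e (suc v))
...   | inj₁ ≤v = inj₂ (zero , subst (1 ≤_) (sym eq) (s≤s z≤n)
  , λ { zero _ → ≤-refl ; (suc w) Dw → ≤-trans ≤v (min w Dw) })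
...   | inj₂ v≤ = inj₂ (suc v , Dv , λ { zero _ → v≤ ; (suc w) → min w })

split-≤ : ∀ k a {b} → k ≤ a + b → ∃ λ k₁ → ∃ λ k₂ → k ≡ k₁ + k₂ × k₁ ≤ a × k₂ ≤ b
split-≤ k a k≤ with k ≤? a
... | yes k≤a = k , 0 , sym (+-identityʳ k) , k≤a , z≤n
... | no k≰a = a , k ∸ a , sym (m+[n∸m]≡n (<⇒≤ (≰⇒> k≰a))) , ≤-refl , m≤n+o⇒m∸n≤o k a k≤

sum≤1 : ∀ {a b} → a + b ≤ 1 → 1 ≤ a → b ≡ 0
sum≤1 {suc zero} {zero} h _ = refl
sum≤1 {suc zero} {suc b} (s≤s ()) _
sum≤1 {suc (suc a)} (s≤s ()) _

2*⌊n/2⌋≤n : ∀ n → 2 * ⌊ n /2⌋ ≤ n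
2*⌊n/2⌋≤n zero = z≤n
2*⌊n/2⌋≤n (suc zero) = z≤n
2*⌊n/2⌋≤n (suc (suc n)) = subst (_≤ suc (suc n)) (sym (*-suc 2 ⌊ n /2⌋)) (s≤s (s≤s (2*⌊n/2⌋≤n n)))

n≤1+2*⌊n/2⌋ : ∀ n → n ≤ suc (2 * ⌊ n /2⌋)
n≤1+2*⌊n/2⌋ zero = z≤n
n≤1+2*⌊n/2⌋ (suc zero) = s≤s z≤n
n≤1+2*⌊n/2⌋ (suc (suc n)) = subst (λ m → suc (suc n) ≤ suc m) (sym (*-suc 2 ⌊ n /2⌋)) (s≤s (s≤s (n≤1+2*⌊n/2⌋ n)))

2^≡suc : ∀ h → ∃ λ m → 2 ^ h ≡ suc m
2^≡suc h with 2 ^ h | m^n>0 2 h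
... | suc m | _ = m , refl

-- Credits of targets and empty leaves

emptyLeaf : Bool → ℕ → ℕ
emptyLeaf true zero = 1
emptyLeaf _ _ = 0

-- The arguments are the remaining demand at a vertex, whether it is a leaf, and its number of
-- pebbles. A target that is also an empty leaf carries only one credit.
credit : ℕ → Bool → ℕ → ℕ
credit zero l c = emptyLeaf l c
credit (suc _) _ _ = 1

emptyLeaf≤1 : ∀ l c → emptyLeaf l c ≤ 1
emptyLeaf≤1 true zero = ≤-refl
emptyLeaf≤1 true (suc _) = z≤n
emptyLeaf≤1 false _ = z≤n

emptyLeaf-anti : ∀ l {c c′} → c′ ≤ c → emptyLeaf l c ≤ emptyLeaf l c′
emptyLeaf-anti true {zero} z≤n = ≤-refl
emptyLeaf-anti true {suc _} _ = z≤n
emptyLeaf-anti false _ = z≤n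

emptyLeaf-occupied : ∀ l {c} → 1 ≤ c → emptyLeaf l c ≡ 0
emptyLeaf-occupied true (s≤s _) = refl
emptyLeaf-occupied false _ = refl

credit≤1 : ∀ d l c → credit d l c ≤ 1
credit≤1 zero l c = emptyLeaf≤1 l c
credit≤1 (suc _) _ _ = ≤-refl

credit-demand : ∀ {d} l c → 1 ≤ d → credit d l c ≡ 1
credit-demand l c (s≤s _) = refl

credit-anti : ∀ d l {c c′} → c′ ≤ c → credit d l c ≤ credit d l c′
credit-anti zero l h = emptyLeaf-anti l h
credit-anti (suc _) l h = ≤-refl

credit≤ : ∀ d l c → credit d l c ≤ emptyLeaf l c + d
credit≤ zero l c = m≤m+n _ 0
credit≤ (suc d) l c = ≤-trans (s≤s z≤n) (m≤n+m (suc d) (emptyLeaf l c))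

emptyLeaf≤credit : ∀ d l c → emptyLeaf l c ≤ credit d l c
emptyLeaf≤credit zero l c = ≤-refl
emptyLeaf≤credit (suc d) l c = emptyLeaf≤1 l c

-- For an inner vertex v some rooting elsewhere is at least as heavy as the one at v and one level
-- higher (see reroot); the π-bounds used below are the ones this height gives.
rerootedHt : Bool → ℕ → ℕ
rerootedHt true h = h
rerootedHt false h = suc h

-- First-child/next-sibling encoding; a tree is a root together with the forest of its subtrees.
data Forest (n : ℕ) : Set where
  nil  : Forest n
  node : Fin n → Forest n → Forest n → Forest n

-- Rooted forests: height, weight, value and multiplicity

module _ {n : ℕ} where

  ΣF : Config n → Forest n → ℕ
  ΣF f nil = 0
  ΣF f (node x ks ss) = f x + ΣF f ks + ΣF f ss

  cnt : Forest n → Config n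
  cnt F w = ΣF (λ x → δ x w) F

  ht : Forest n → ℕ
  ht nil = 0
  ht (node x ks ss) = suc (ht ks) ⊔ ht ss

  -- In a maximum path partition with path lengths `a_i` the powers along one path add up to
  -- `2 ^ a_i - 1`. Hence `W F + k * 2 ^ ht F + 1` is the classical path-partition formula for
  -- trees.
  W : Forest n → ℕ
  W nil = 0
  W (node x ks ss) = 2 ^ ht ks + W ks + W ss

  -- inc C F is the number of pebbles that C can move from F to the parent of its trees, val the
  -- number it can gather at the root p.
  inc : Config n → Forest n → ℕ
  inc C nil = 0
  inc C (node x ks ss) = ⌊ C x + inc C ks /2⌋ + inc C ss

  val : Config n → Fin n → Forest n → ℕ
  val C p F = C p + inc C F

  val-node : ∀ C p x ks ss → val C p (node x ks ss) ≡ ⌊ val C x ks /2⌋ + val C p ss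
  val-node C p x ks ss = x∙yz≈y∙xz (C p) ⌊ val C x ks /2⌋ (inc C ss)

  data Par : Fin n → Forest n → Fin n → Fin n → Set where
    top : ∀ {p x ks ss} → Par p (node x ks ss) p x
    kid : ∀ {p x ks ss a b} → Par x ks a b → Par p (node x ks ss) a b
    sib : ∀ {p x ks ss a b} → Par p ss a b → Par p (node x ks ss) a b

  -- Multiplicities stand in for membership: disjointness of branches and covering of all vertices
  -- become the numerical conditions `≤ 1` and `≡ 1`.
  occ : Fin n → Forest n → Config n
  occ p F w = δ p w + cnt F w

  Distinct : Fin n → Forest n → Set
  Distinct p F = ∀ w → occ p F w ≤ 1

  occ-top : ∀ p F → 1 ≤ occ p F p
  occ-top p F = subst (λ m → 1 ≤ m + cnt F p) (sym (δ-refl p)) (s≤s z≤n)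

  -- The inductions cut a tree here: the first branch is a tree rooted at `x`, and what is left is a
  -- tree still rooted at `p`.
  occ-split : ∀ p x ks ss w → occ p (node x ks ss) w ≡ occ x ks w + occ p ss w
  occ-split p x ks ss w = lem (δ p w) (δ x w) (cnt ks w) (cnt ss w)
    where
    lem : ∀ a b c d → a + (b + c + d) ≡ b + c + (a + d)
    lem = solve-∀

  par-child : ∀ {p F a b} → Par p F a b → 1 ≤ cnt F b
  par-child {F = node x ks ss} top = ≤-trans (occ-top x ks) (m≤m+n _ (cnt ss x))
  par-child {F = node x ks ss} {b = b} (kid h) = ≤-trans (≤-trans (par-child h) (m≤n+m _ (δ x b))) (m≤m+n _ (cnt ss b))
  par-child {F = node x ks ss} {b = b} (sib h) = ≤-trans (par-child h) (m≤n+m _ (δ x b + cnt ks b))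

  par-occ-child : ∀ {p F a b} → Par p F a b → 1 ≤ occ p F b
  par-occ-child {p} {b = b} h = ≤-trans (par-child h) (m≤n+m _ (δ p b))

  par-parent : ∀ {p F a b} → Par p F a b → 1 ≤ occ p F a
  par-parent {p} {F = F@(node x ks ss)} top = occ-top p F
  par-parent {p} {F = node x ks ss} {a} (kid h) =
    subst (1 ≤_) (sym (occ-split p x ks ss a)) (≤-trans (par-parent h) (m≤m+n _ _))
  par-parent {p} {F = node x ks ss} {a} (sib h) =
    subst (1 ≤_) (sym (occ-split p x ks ss a)) (≤-trans (par-parent h) (m≤n+m _ (occ x ks a)))

  occ≤-kids : ∀ p x ks ss w {k} → occ p (node x ks ss) w ≤ k → occ x ks w ≤ k
  occ≤-kids p x ks ss w h = ≤-trans (≤-trans (m≤m+n _ _) (≤-reflexive (sym (occ-split p x ks ss w)))) h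

  occ≤-sibs : ∀ p x ks ss w {k} → occ p (node x ks ss) w ≤ k → occ p ss w ≤ k
  occ≤-sibs p x ks ss w h = ≤-trans (≤-trans (m≤n+m _ (occ x ks w)) (≤-reflexive (sym (occ-split p x ks ss w)))) h

  kids⇒∉sibs : ∀ p x ks ss w → occ p (node x ks ss) w ≤ 1 → 1 ≤ occ x ks w → occ p ss w ≡ 0
  kids⇒∉sibs p x ks ss w h i = sum≤1 (subst (_≤ 1) (occ-split p x ks ss w) h) i

  sibs⇒∉kids : ∀ p x ks ss w → occ p (node x ks ss) w ≤ 1 → 1 ≤ occ p ss w → occ x ks w ≡ 0
  sibs⇒∉kids p x ks ss w h i =
    sum≤1 (subst (_≤ 1) (trans (occ-split p x ks ss w) (+-comm (occ x ks w) _)) h) i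

  -- Pebbling steps do not increase the value

  inc-mono : ∀ {C C' : Config n} F → (∀ w → 1 ≤ cnt F w → C' w ≤ C w) → inc C' F ≤ inc C F
  val-mono : ∀ {C C' : Config n} p F → (∀ w → 1 ≤ occ p F w → C' w ≤ C w) → val C' p F ≤ val C p F
  val-mono p F h = +-mono-≤ (h p (occ-top p F)) (inc-mono F (λ w i → h w (≤-trans i (m≤n+m _ (δ p w)))))
  inc-mono nil h = z≤n
  inc-mono (node x ks ss) h =
    +-mono-≤ (⌊n/2⌋-mono (val-mono x ks (λ w i → h w (≤-trans i (m≤m+n _ (cnt ss w))))))
             (inc-mono ss (λ w i → h w (≤-trans i (m≤n+m _ (δ x w + cnt ks w)))))

  module _ {C C' : Config n} {u w : Fin n} (lose : 2 + C' u ≤ C u) (gain : C' w ≤ suc (C w))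
           (others : ∀ z → z ≢ w → C' z ≤ C z) where

    off : ∀ {f : Config n} → f w ≡ 0 → ∀ z → 1 ≤ f z → C' z ≤ C z
    off fw z i = others z λ { refl → <⇒≢ i (sym fw) }

    val-off : ∀ p F → occ p F w ≡ 0 → val C' p F ≤ val C p F
    val-off p F h = val-mono p F (off {occ p F} h)

    inc-off : ∀ F → cnt F w ≡ 0 → inc C' F ≤ inc C F
    inc-off F h = inc-mono F (off {cnt F} h)

    -- Towards the root, the two pebbles lost at the child lower its half by exactly the one gained
    -- at the parent. Away from the root, the half of the child grows by at most one while the
    -- parent loses two. Deeper in the tree only one of the two parts contains `w`, and the other
    -- part can only lose pebbles.
    val-step : ∀ p F → occ p F w ≤ 1 → Par p F u w ⊎ Par p F w u → val C' p F ≤ val C p F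
    val-step-kid : ∀ p x ks ss → occ p (node x ks ss) w ≤ 1 → Par x ks u w ⊎ Par x ks w u →
                   1 ≤ occ x ks w → val C' p (node x ks ss) ≤ val C p (node x ks ss)
    val-step-sib : ∀ p x ks ss → occ p (node x ks ss) w ≤ 1 → Par p ss u w ⊎ Par p ss w u →
                   1 ≤ occ p ss w → val C' p (node x ks ss) ≤ val C p (node x ks ss)
    val-step-kid p x ks ss h e i = begin
      val C' p (node x ks ss) ≡⟨ val-node C' p x ks ss ⟩
      ⌊ val C' x ks /2⌋ + val C' p ss ≤⟨ +-mono-≤ (⌊n/2⌋-mono (val-step x ks (occ≤-kids p x ks ss w h) e))
                                           (val-off p ss (kids⇒∉sibs p x ks ss w h i)) ⟩
      ⌊ val C x ks /2⌋ + val C p ss ≡⟨ val-node C p x ks ss ⟨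
      val C p (node x ks ss) ∎
      where open ≤-Reasoning
    val-step-sib p x ks ss h e i = begin
      val C' p (node x ks ss) ≡⟨ val-node C' p x ks ss ⟩
      ⌊ val C' x ks /2⌋ + val C' p ss ≤⟨ +-mono-≤ (⌊n/2⌋-mono (val-off x ks (sibs⇒∉kids p x ks ss w h i)))
                                           (val-step p ss (occ≤-sibs p x ks ss w h) e) ⟩
      ⌊ val C x ks /2⌋ + val C p ss ≡⟨ val-node C p x ks ss ⟨
      val C p (node x ks ss) ∎
      where open ≤-Reasoning
    val-step p (node x ks ss) h (inj₁ top) = begin
      C' p + (⌊ C' x + inc C' ks /2⌋ + inc C' ss)
        -- The one pebble gained at `x` is relaxed to two, so that the half grows by exactly one.
        ≤⟨ +-monoʳ-≤ (C' p) (+-mono-≤ (⌊n/2⌋-mono (≤-trans (+-mono-≤ gain (inc-off ks k0)) (n≤1+n _))) (inc-off ss s0)) ⟩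
      C' p + (suc ⌊ C x + inc C ks /2⌋ + inc C ss)
        ≡⟨ +-suc (C' p) _ ⟩
      suc (C' p) + (⌊ C x + inc C ks /2⌋ + inc C ss)
        ≤⟨ +-monoˡ-≤ _ (≤-trans (n≤1+n _) lose) ⟩
      C p + (⌊ C x + inc C ks /2⌋ + inc C ss) ∎
      where
      open ≤-Reasoning
      k0 : cnt ks w ≡ 0
      k0 = sum≤1 {δ x w} (occ≤-kids p x ks ss w h) (≤-reflexive (sym (δ-refl x)))
      s0 : cnt ss w ≡ 0
      s0 = m+n≡0⇒n≡0 (δ p w) (kids⇒∉sibs p x ks ss w h (occ-top x ks))
    val-step p (node x ks ss) h (inj₂ top) = begin
      C' p + (⌊ C' x + inc C' ks /2⌋ + inc C' ss)
        ≤⟨ +-monoˡ-≤ _ gain ⟩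
      suc (C p) + (⌊ C' x + inc C' ks /2⌋ + inc C' ss)
        ≡⟨ +-suc (C p) _ ⟨
      C p + (⌊ 2 + C' x + inc C' ks /2⌋ + inc C' ss)
        ≤⟨ +-monoʳ-≤ (C p) (+-mono-≤ (⌊n/2⌋-mono (+-mono-≤ lose (inc-off ks (m+n≡0⇒n≡0 (δ x w) k0)))) (inc-off ss s0)) ⟩
      C p + (⌊ C x + inc C ks /2⌋ + inc C ss) ∎
      where
      open ≤-Reasoning
      k0 : occ x ks w ≡ 0
      k0 = sibs⇒∉kids p x ks ss w h (occ-top p ss)
      s0 : cnt ss w ≡ 0
      s0 = sum≤1 {δ p w} (occ≤-sibs p x ks ss w h) (≤-reflexive (sym (δ-refl p)))
    val-step p (node x ks ss) h (inj₁ (kid e)) = val-step-kid p x ks ss h (inj₁ e) (par-occ-child e)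
    val-step p (node x ks ss) h (inj₂ (kid e)) = val-step-kid p x ks ss h (inj₂ e) (par-parent e)
    val-step p (node x ks ss) h (inj₁ (sib e)) = val-step-sib p x ks ss h (inj₁ e) (par-occ-child e)
    val-step p (node x ks ss) h (inj₂ (sib e)) = val-step-sib p x ks ss h (inj₂ e) (par-parent e)

  -- Bounding the size by the value

  size-*cnt : ∀ (f : Config n) F → size (λ w → f w * cnt F w) ≡ ΣF f F
  size-*cnt f nil = trans (size-cong (λ w → *-zeroʳ (f w))) (size-0 n)
  size-*cnt f (node x ks ss) = begin
    size (λ w → f w * (δ x w + cnt ks w + cnt ss w))
      ≡⟨ size-cong (λ w → distr (f w) (δ x w) (cnt ks w) (cnt ss w)) ⟩
    size (fδ ⊕ fk ⊕ fs)
      ≡⟨ trans (size-⊕ (fδ ⊕ fk) fs) (cong (_+ size fs) (size-⊕ fδ fk)) ⟩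
    size fδ + size fk + size fs
      ≡⟨ cong₂ _+_ (cong₂ _+_ (size-*δ f x) (size-*cnt f ks)) (size-*cnt f ss) ⟩
    f x + ΣF f ks + ΣF f ss ∎
    where
    open ≡-Reasoning
    fδ fk fs : Config n
    fδ w = f w * δ x w
    fk w = f w * cnt ks w
    fs w = f w * cnt ss w
    distr : ∀ a b c d → a * (b + c + d) ≡ a * b + a * c + a * d
    distr = solve-∀

  Spans : Fin n → Forest n → Set
  Spans r F = ∀ w → occ r F w ≡ 1

  size-spans : ∀ {r F} → Spans r F → ∀ f → size f ≡ f r + ΣF f F
  size-spans {r} {F} h f = begin
    size f ≡⟨ size-cong (λ w → trans (sym (*-identityʳ (f w))) (trans (cong (f w *_) (sym (h w))) (*-distribˡ-+ (f w) (δ r w) _))) ⟩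
    size ((λ w → f w * δ r w) ⊕ (λ w → f w * cnt F w)) ≡⟨ size-⊕ (λ w → f w * δ r w) (λ w → f w * cnt F w) ⟩
    size (λ w → f w * δ r w) + size (λ w → f w * cnt F w) ≡⟨ cong₂ _+_ (size-*δ f r) (size-*cnt f F) ⟩
    f r + ΣF f F ∎
    where open ≡-Reasoning

  -- i marks empty leaves: each wastes the one pebble that rounding would have forgiven.
  module _ (C i : Config n) (R : Fin n → Fin n → Set) (i≤1 : ∀ u → i u ≤ 1)
           (occupied : ∀ u → 1 ≤ C u → i u ≡ 0) (inner : ∀ {p u k} → R p u → R u k → i u ≡ 0) where

    upper : ∀ p F → (∀ {a b} → Par p F a b → R a b) → ΣF C F + ΣF i F ≤ inc C F * 2 ^ ht F + W F
    upper-kid : ∀ p x ks → R p x → (∀ {a b} → Par x ks a b → R a b) →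
      (C x + ΣF C ks) + (i x + ΣF i ks) ≤ ⌊ val C x ks /2⌋ * 2 ^ suc (ht ks) + (2 ^ ht ks + W ks)
    upper p nil h = z≤n
    upper p (node x ks ss) h = begin
      (C x + ΣF C ks + ΣF C ss) + (i x + ΣF i ks + ΣF i ss)
        ≡⟨ interchange (C x + ΣF C ks) (ΣF C ss) (i x + ΣF i ks) (ΣF i ss) ⟩
      (C x + ΣF C ks + (i x + ΣF i ks)) + (ΣF C ss + ΣF i ss)
        ≤⟨ +-mono-≤ (upper-kid p x ks (h top) (λ e → h (kid e))) (upper p ss (λ e → h (sib e))) ⟩
      (a * 2 ^ suc (ht ks) + (2 ^ ht ks + W ks)) + (b * 2 ^ ht ss + W ss)
        ≤⟨ +-mono-≤ (+-monoˡ-≤ _ (*-monoʳ-≤ a (^-monoʳ-≤ 2 (m≤m⊔n (suc (ht ks)) (ht ss)))))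
                    (+-monoˡ-≤ _ (*-monoʳ-≤ b (^-monoʳ-≤ 2 (m≤n⊔m (suc (ht ks)) (ht ss))))) ⟩
      (a * H + (2 ^ ht ks + W ks)) + (b * H + W ss)
        ≡⟨ regroup a b H _ _ ⟩
      (a + b) * H + (2 ^ ht ks + W ks + W ss) ∎
      where
      open ≤-Reasoning
      a = ⌊ val C x ks /2⌋
      b = inc C ss
      H = 2 ^ (suc (ht ks) ⊔ ht ss)
      regroup : ∀ a b c d e → (a * c + d) + (b * c + e) ≡ (a + b) * c + (d + e)
      regroup = solve-∀
    -- At a leaf rounding forgives one pebble. An occupied leaf uses this up and has no mark; an
    -- empty leaf leaves it to its mark.
    upper-kid p x nil Rpx h with 1 ≤? C x
    ... | yes Cx = begin
      (C x + 0) + (i x + 0) ≡⟨ cong (λ m → C x + 0 + (m + 0)) (occupied x Cx) ⟩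
      (C x + 0) + 0 ≡⟨ +-identityʳ _ ⟩
      C x + 0 ≤⟨ n≤1+2*⌊n/2⌋ (C x + 0) ⟩
      suc (2 * ⌊ C x + 0 /2⌋) ≡⟨ tidy ⌊ C x + 0 /2⌋ ⟩
      ⌊ C x + 0 /2⌋ * 2 + 1 ∎
      where
      open ≤-Reasoning
      tidy : ∀ a → suc (2 * a) ≡ a * 2 + 1
      tidy = solve-∀
    ... | no Cx = begin
      (C x + 0) + (i x + 0) ≡⟨ cong₂ _+_ (trans (+-identityʳ (C x)) (n<1⇒n≡0 (≰⇒> Cx))) (+-identityʳ (i x)) ⟩
      i x ≤⟨ i≤1 x ⟩
      1 ≤⟨ m≤n+m 1 (⌊ C x + 0 /2⌋ * 2) ⟩
      ⌊ C x + 0 /2⌋ * 2 + 1 ∎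
      where open ≤-Reasoning
    upper-kid p x ks@(node _ _ _) Rpx h = begin
      -- Here `x` has the parent `p` and a child, so `inner` clears its mark.
      (C x + ΣF C ks) + (i x + ΣF i ks) ≡⟨ cong (λ m → (C x + ΣF C ks) + (m + ΣF i ks)) (inner Rpx (h top)) ⟩
      (C x + ΣF C ks) + ΣF i ks ≡⟨ +-assoc (C x) _ _ ⟩
      C x + (ΣF C ks + ΣF i ks) ≤⟨ +-mono-≤ (m≤m*n (C x) (2 ^ ht ks) {{m^n≢0 2 (ht ks)}}) (upper x ks h) ⟩
      C x * H + (inc C ks * H + W ks) ≡⟨ regroup (C x) (inc C ks) H (W ks) ⟩
      -- Halving loses at most one unit of `m`. Its weight `H` is the summand of `x` in `W`.
      m * H + W ks ≤⟨ +-monoˡ-≤ (W ks) (*-monoˡ-≤ H (n≤1+2*⌊n/2⌋ m)) ⟩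
      suc (2 * ⌊ m /2⌋) * H + W ks ≡⟨ tidy ⌊ m /2⌋ H (W ks) ⟩
      ⌊ m /2⌋ * (2 * H) + (H + W ks) ∎
      where
      open ≤-Reasoning
      m = val C x ks
      H = 2 ^ ht ks
      regroup : ∀ a b c d → a * c + (b * c + d) ≡ (a + b) * c + d
      regroup = solve-∀
      tidy : ∀ a b c → suc (2 * a) * b + c ≡ a * (2 * b) + (b + c)
      tidy = solve-∀

    upper-val : ∀ {r F} → Spans r F → (∀ {a b} → Par r F a b → R a b) →
                size C + ΣF i F ≤ val C r F * 2 ^ ht F + W F
    upper-val {r} {F} sp h = begin
      size C + ΣF i F ≡⟨ cong (_+ ΣF i F) (size-spans {r} {F} sp C) ⟩
      C r + ΣF C F + ΣF i F ≡⟨ +-assoc (C r) _ _ ⟩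
      C r + (ΣF C F + ΣF i F) ≤⟨ +-mono-≤ (m≤m*n (C r) H {{m^n≢0 2 (ht F)}}) (upper r F h) ⟩
      C r * H + (inc C F * H + W F) ≡⟨ regroup (C r) (inc C F) H (W F) ⟩
      val C r F * H + W F ∎
      where
      open ≤-Reasoning
      H = 2 ^ ht F
      regroup : ∀ a b c d → a * c + (b * c + d) ≡ (a + b) * c + d
      regroup = solve-∀

  -- Large configurations of small value

  Bad : Fin n → Forest n → ℕ → ℕ → Set
  Bad p F k s = ∃ λ B → (∀ w → occ p F w ≡ 0 → B w ≡ 0) × val B p F ≤ k × s ≤ size B

  -- The supports lie in disjoint parts, so the sum agrees with one of the two configurations on
  -- each part. A value `k₁` at `x` is worth only its half at `p`.
  bad-join : ∀ {p x ks ss k₁ k₂ s₁ s₂} → Distinct p (node x ks ss) →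
             Bad x ks k₁ s₁ → Bad p ss k₂ s₂ → Bad p (node x ks ss) (⌊ k₁ /2⌋ + k₂) (s₁ + s₂)
  bad-join {p} {x} {ks} {ss} {k₁} {k₂} {s₁} {s₂} dis (B₁ , supp₁ , val₁ , size₁) (B₂ , supp₂ , val₂ , size₂) =
    B₁ ⊕ B₂ , supp , bound , ≤-trans (+-mono-≤ size₁ size₂) (≤-reflexive (sym (size-⊕ B₁ B₂)))
    where
    supp : ∀ w → occ p (node x ks ss) w ≡ 0 → B₁ w + B₂ w ≡ 0
    supp w h with trans (sym (occ-split p x ks ss w)) h
    ... | h′ = cong₂ _+_ (supp₁ w (m+n≡0⇒m≡0 (occ x ks w) h′)) (supp₂ w (m+n≡0⇒n≡0 (occ x ks w) h′))
    on₁ : ∀ w → 1 ≤ occ x ks w → B₁ w + B₂ w ≤ B₁ w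
    on₁ w i = ≤-reflexive (trans (cong (B₁ w +_) (supp₂ w (kids⇒∉sibs p x ks ss w (dis w) i))) (+-identityʳ _))
    on₂ : ∀ w → 1 ≤ occ p ss w → B₁ w + B₂ w ≤ B₂ w
    on₂ w i = ≤-reflexive (cong (_+ B₂ w) (supp₁ w (sibs⇒∉kids p x ks ss w (dis w) i)))
    bound : val (B₁ ⊕ B₂) p (node x ks ss) ≤ ⌊ k₁ /2⌋ + k₂
    bound = begin
      val (B₁ ⊕ B₂) p (node x ks ss) ≡⟨ val-node (B₁ ⊕ B₂) p x ks ss ⟩
      ⌊ val (B₁ ⊕ B₂) x ks /2⌋ + val (B₁ ⊕ B₂) p ss
        ≤⟨ +-mono-≤ (⌊n/2⌋-mono (≤-trans (val-mono x ks on₁) val₁)) (≤-trans (val-mono p ss on₂) val₂) ⟩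
      ⌊ k₁ /2⌋ + k₂ ∎
      where open ≤-Reasoning

  -- A deepest child gets budget 2k + 1 and every other child 1, which is lost to rounding.
  bad : ∀ p F k → Distinct p F → Bad p F k (W F + k * 2 ^ ht F)
  bad p nil k dis = k ⊙ δ p , (λ w h → trans (cong (k *_) (m+n≡0⇒m≡0 (δ p w) h)) (*-zeroʳ k))
    , ≤-reflexive (trans (+-identityʳ _) (trans (cong (k *_) (δ-refl p)) (*-identityʳ k)))
    , ≤-reflexive (trans (*-identityʳ k) (sym (size-k⊙δ k p)))
  bad p (node x ks ss) k dis
    with ≤-total (ht ss) (suc (ht ks)) | (λ w → occ≤-kids p x ks ss w (dis w))
       | (λ w → occ≤-sibs p x ks ss w (dis w))
  -- Budget 0 for the remaining branches still leaves each child there the budget `2 * 0 + 1`.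
  ... | inj₁ h | dk | ds rewrite m≥n⇒m⊔n≡m h =
    subst₂ (Bad p (node x ks ss)) (trans (+-identityʳ _) (half k)) (tidy (W ks) k (2 ^ ht ks) (W ss))
      (bad-join {p} {x} {ks} {ss} dis (bad x ks (suc (2 * k)) dk) (bad p ss 0 ds))
    where
    half : ∀ k → ⌊ suc (2 * k) /2⌋ ≡ k
    half zero = refl
    half (suc k) = trans (cong (λ m → ⌊ suc m /2⌋) (*-suc 2 k)) (cong suc (half k))
    tidy : ∀ a b c d → a + suc (2 * b) * c + (d + 0) ≡ c + a + d + b * (2 * c)
    tidy = solve-∀
  ... | inj₂ h | dk | ds rewrite m≤n⇒m⊔n≡n h =
    subst (Bad p (node x ks ss) k) (tidy (W ks) (2 ^ ht ks) (W ss) (k * 2 ^ ht ss))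
      (bad-join {p} {x} {ks} {ss} dis (bad x ks 1 dk) (bad p ss k ds))
    where
    tidy : ∀ a b c d → a + 1 * b + (c + d) ≡ b + a + c + d
    tidy = solve-∀

  -- Levels, growth by a leaf, and connectivity of rooted trees

  grade : ∀ p F j → Distinct p F →
          ∃ λ (φ : Config n) → φ p ≡ j × (∀ {a b} → Par p F a b → φ b ≡ suc (φ a))
  grade p nil j dis = (λ _ → j) , refl , λ ()
  grade p F@(node x ks ss) j dis
    with grade x ks (suc j) (λ w → occ≤-kids p x ks ss w (dis w))
       | grade p ss j (λ w → occ≤-sibs p x ks ss w (dis w))
  ... | φ₁ , φ₁x , g₁ | φ₂ , φ₂p , g₂ = φ , trans (φ≡φ₂ (occ-top p ss)) φ₂p , g
    where
    -- Distinctness lets the levels of the two parts be glued without conflict.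
    φ : Config n
    φ w = if does (1 ≤? occ x ks w) then φ₁ w else φ₂ w
    φ≡φ₁ : ∀ {w} → 1 ≤ occ x ks w → φ w ≡ φ₁ w
    φ≡φ₁ {w} i = cong (λ b → if b then φ₁ w else φ₂ w) (dec-true (1 ≤? occ x ks w) i)
    φ≡φ₂ : ∀ {w} → 1 ≤ occ p ss w → φ w ≡ φ₂ w
    φ≡φ₂ {w} i = cong (λ b → if b then φ₁ w else φ₂ w)
      (dec-false (1 ≤? occ x ks w) λ i′ → <⇒≢ i′ (sym (sibs⇒∉kids p x ks ss w (dis w) i)))
    g : ∀ {a b} → Par p F a b → φ b ≡ suc (φ a)
    g top = trans (φ≡φ₁ (occ-top x ks)) (trans φ₁x (cong suc (sym (trans (φ≡φ₂ (occ-top p ss)) φ₂p))))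
    g (kid e) = trans (φ≡φ₁ (par-occ-child e)) (trans (g₁ e) (cong suc (sym (φ≡φ₁ (par-parent e)))))
    g (sib e) = trans (φ≡φ₂ (par-occ-child e)) (trans (g₂ e) (cong suc (sym (φ≡φ₂ (par-parent e)))))

  -- This is the growth step for spanning trees: a new vertex `w` hangs as a leaf below `u`, so the
  -- only new parent edge goes from `u` to `w`.
  insert : ∀ u w p F → 1 ≤ occ p F u →
           ∃ λ (F′ : Forest n) → (∀ z → cnt F′ z ≡ δ w z + cnt F z) ×
                             (∀ {a b} → Par p F′ a b → (a ≡ u × b ≡ w) ⊎ Par p F a b)
  insert u w p F i with u ≟ p
  ... | yes refl = node w nil F , (λ z → cong (_+ cnt F z) (+-identityʳ (δ w z)))
                   , λ { top → inj₁ (refl , refl) ; (sib e) → inj₂ e }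
  insert u w p (node x ks ss) i | no u≢p with 1 ≤? occ x ks u
  ... | yes i₁ with insert u w x ks i₁
  ...   | F′ , c , q = node x F′ ss ,
      (λ z → trans (cong (λ m → δ x z + m + cnt ss z) (c z)) (move-out (δ x z) (δ w z) _ _)) ,
      λ { top → inj₂ top ; (kid e) → [ inj₁ , (λ e′ → inj₂ (kid e′)) ]′ (q e) ; (sib e) → inj₂ (sib e) }
    where
    move-out : ∀ a b c d → a + (b + c) + d ≡ b + (a + c + d)
    move-out = solve-∀
  insert u w p (node x ks ss) i | no u≢p | no ¬i₁ with insert u w p ss
    (≤-trans (subst (λ m → 1 ≤ m + cnt ss u) (n<1⇒n≡0 (≰⇒> ¬i₁)) i) (m≤n+m _ (δ p u)))
  ...   | F′ , c , q = node x ks F′ ,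
      (λ z → trans (cong (δ x z + cnt ks z +_) (c z)) (x∙yz≈y∙xz (δ x z + cnt ks z) (δ w z) _)) ,
      λ { top → inj₂ top ; (kid e) → inj₂ (kid e) ; (sib e) → [ inj₁ , (λ e′ → inj₂ (sib e′)) ]′ (q e) }

  occ⇒star : ∀ {R : Fin n → Fin n → Set} p F → (∀ {a b} → Par p F a b → R a b) → ∀ z → 1 ≤ occ p F z → Star R p z
  occ⇒star p nil f z i rewrite 1≤δ⇒≡ {x = p} {z} (≤-trans i (≤-reflexive (+-identityʳ _))) = ε
  occ⇒star p (node x ks ss) f z i with 1 ≤? occ x ks z
  ... | yes i₁ = f top ◅ occ⇒star x ks (λ e → f (kid e)) z i₁
  ... | no ¬i₁ = occ⇒star p ss (λ e → f (sib e)) z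
    (subst (1 ≤_) (trans (occ-split p x ks ss z) (cong (_+ occ p ss z) (n<1⇒n≡0 (≰⇒> ¬i₁)))) i)

  -- Applied to the tree rooted at `v` itself, this decides whether `v` has at most one neighbour;
  -- the tree on a single vertex counts as a leaf.
  atMostOne : Forest n → Bool
  atMostOne nil = true
  atMostOne (node _ _ nil) = true
  atMostOne (node _ _ (node _ _ _)) = false

  k⊙δ≤ : ∀ {C : Config n} {k x} → k ≤ C x → ∀ w → k * δ x w ≤ C w * δ x w
  k⊙δ≤ {C} {k} {x} h w with w ≟ x
  ... | yes refl = *-monoˡ-≤ 1 h
  ... | no _ = ≤-reflexive (trans (*-zeroʳ k) (sym (*-zeroʳ (C w))))

  ΣF-mono : ∀ {f g : Config n} → f ≤ᶜ g → ∀ F → ΣF f F ≤ ΣF g F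
  ΣF-mono h nil = z≤n
  ΣF-mono h (node x ks ss) = +-mono-≤ (+-mono-≤ (h x) (ΣF-mono h ks)) (ΣF-mono h ss)

  ΣF-⊕ : ∀ (f g : Config n) F → ΣF (f ⊕ g) F ≡ ΣF f F + ΣF g F
  ΣF-⊕ f g nil = refl
  ΣF-⊕ f g (node x ks ss) = trans (cong₂ _+_ (cong (f x + g x +_) (ΣF-⊕ f g ks)) (ΣF-⊕ f g ss))
    (exch (f x) (g x) (ΣF f ks) (ΣF g ks) (ΣF f ss) (ΣF g ss))
    where
    exch : ∀ a b c d e h → a + b + (c + d) + (e + h) ≡ a + c + e + (b + d + h)
    exch = solve-∀

  0<ht : ∀ {v w : Fin n} {F} → Spans v F → w ≢ v → 1 ≤ ht F
  0<ht {v} {w} {nil} sp w≢v = ⊥-elim (w≢v (1≤δ⇒≡ {x = v} {w} (≤-reflexive (sym (trans (sym (+-identityʳ _)) (sp w))))))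
  0<ht {F = node x ks ss} sp w≢v = ≤-trans (s≤s z≤n) (m≤m⊔n (suc (ht ks)) (ht ss))

-- Pebbling sequences in a frame

module _ {n : ℕ} (T : Graph n) where

  open DecMembership (_≟_ {n}) using (_∈?_)

  -- Quantifying over the frame X makes reachability additive without function extensionality.
  Reach : Config n → Config n → ℕ → Set
  Reach U V c = ∀ X B → (U ⊕ X) ≤ᶜ B → ∃ λ B′ → Steps T B B′ c × (V ⊕ X) ≤ᶜ B′

  steps-++ : ∀ {A B C a b} → Steps T A B a → Steps T B C b → Steps T A C (a + b)
  steps-++ done t = t
  steps-++ (step e l s) t = step e l (steps-++ s t)

  reach-refl : ∀ {U} → Reach U U 0
  reach-refl X B h = B , done , h

  reach-trans : ∀ {U V Y a b} → Reach U V a → Reach V Y b → Reach U Y (a + b)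
  reach-trans f g X B h with f X B h
  ... | B₁ , s₁ , h₁ with g X B₁ h₁
  ...   | B₂ , s₂ , h₂ = B₂ , steps-++ s₁ s₂ , h₂

  reach-weaken : ∀ {U U′ V V′ c} → U ≤ᶜ U′ → V′ ≤ᶜ V → Reach U V c → Reach U′ V′ c
  reach-weaken u v f X B h with f X B (λ w → ≤-trans (+-monoˡ-≤ (X w) (u w)) (h w))
  ... | B′ , s , h′ = B′ , s , λ w → ≤-trans (+-monoˡ-≤ (X w) (v w)) (h′ w)

  -- The first sequence runs with `U₂` in its frame, the second with the result `V₁` in its frame.
  reach-⊕ : ∀ {U₁ V₁ U₂ V₂ a b} → Reach U₁ V₁ a → Reach U₂ V₂ b → Reach (U₁ ⊕ U₂) (V₁ ⊕ V₂) (a + b)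
  reach-⊕ {U₁} {V₁} {U₂} {V₂} f g X B h
    with f (U₂ ⊕ X) B (λ w → ≤-trans (≤-reflexive (sym (+-assoc (U₁ w) _ _))) (h w))
  ... | B₁ , s₁ , h₁ with g (V₁ ⊕ X) B₁ (λ w → ≤-trans (≤-reflexive (x∙yz≈y∙xz (U₂ w) (V₁ w) (X w))) (h₁ w))
  ...   | B₂ , s₂ , h₂ = B₂ , steps-++ s₁ s₂ , λ w → ≤-trans (≤-reflexive (exch (V₁ w) (V₂ w) (X w))) (h₂ w)
    where
    exch : ∀ a b c → a + b + c ≡ b + (a + c)
    exch = solve-∀

  reach-edge : ∀ {u w} → E T u w → Reach (2 ⊙ δ u) (δ w) 1
  reach-edge {u} {w} e X B h = move u w B , step e 2≤ done , after
    where
    w≢u : w ≢ u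
    w≢u refl = E-irrefl T e
    2≤ : 2 ≤ B u
    2≤ = ≤-trans (m≤m+n 2 (X u)) (subst (λ m → 2 * m + X u ≤ B u) (δ-refl u) (h u))
    after : ∀ z → δ w z + X z ≤ move u w B z
    after z with z ≟ u | z ≟ w | h z
    ... | yes refl | yes u≡w | _ = ⊥-elim (w≢u (sym u≡w))
    ... | yes refl | no _ | hz = m+n≤o⇒m≤o∸n (X z) (≤-trans (≤-reflexive (+-comm (X z) 2)) hz)
    ... | no _ | yes _ | hz = s≤s hz
    ... | no _ | no _ | hz = hz

  reach-edge* : ∀ {u w} k → E T u w → Reach ((2 * k) ⊙ δ u) (k ⊙ δ w) k
  reach-edge* zero e = reach-refl
  reach-edge* {u} {w} (suc k) e = reach-weaken (λ z → ≤-reflexive (lem k (δ u z))) (λ z → ≤-refl)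
      (reach-⊕ (reach-edge e) (reach-edge* k e))
    where
    lem : ∀ k d → 2 * d + 2 * k * d ≡ 2 * suc k * d
    lem = solve-∀

  -- The value as an invariant, and greedy delivery that attains it

  steps-val : ∀ {r F} → Spans r F → (∀ {a b} → E T a b → Par r F a b ⊎ Par r F b a) →
              ∀ {C C′ c} → Steps T C C′ c → val C′ r F ≤ val C r F
  steps-val sp complete done = ≤-refl
  steps-val {r} {F} sp complete {C} (step {u = u} {w} e 2≤ s) =
    ≤-trans (steps-val sp complete s) (val-step lose gain others r F (≤-reflexive (sp w)) (complete e))
    where
    lose : 2 + move u w C u ≤ C u
    lose with u ≟ u
    ... | yes _ = ≤-reflexive (m+[n∸m]≡n 2≤)
    ... | no u≢u = ⊥-elim (u≢u refl)
    gain : move u w C w ≤ suc (C w)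
    gain with w ≟ u | w ≟ w
    ... | yes _ | _ = ≤-trans (m∸n≤m (C w) 2) (n≤1+n _)
    ... | no _ | yes _ = ≤-refl
    ... | no _ | no _ = n≤1+n _
    others : ∀ z → z ≢ w → move u w C z ≤ C z
    others z z≢w with z ≟ u | z ≟ w
    ... | yes _ | _ = m∸n≤m (C z) 2
    ... | no _ | yes z≡w = ⊥-elim (z≢w z≡w)
    ... | no _ | no _ = ≤-refl

  -- Each step destroys one pebble, hence `size-used`; for `k = 1` it says that the cost is the
  -- number of pebbles used. `cheap` charges at most `2 ^ h` of them to every delivered pebble.
  record Delivery (C : Config n) (p : Fin n) (k h : ℕ) : Set where
    constructor delivery
    field
      used      : Config n
      steps     : ℕ
      reach     : Reach used (k ⊙ δ p) steps
      used≤     : used ≤ᶜ C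
      size-used : size used ≡ steps + k
      cheap     : size used ≤ k * 2 ^ h

  delivery-⊕ : ∀ {C₁ C₂ C p a b h₁ h₂ h} → h₁ ≤ h → h₂ ≤ h → (C₁ ⊕ C₂) ≤ᶜ C →
               Delivery C₁ p a h₁ → Delivery C₂ p b h₂ → Delivery C p (a + b) h
  delivery-⊕ {p = p} {a} {b} {h₁} {h₂} {h} l₁ l₂ l (delivery U₁ c₁ r₁ u₁ e₁ k₁) (delivery U₂ c₂ r₂ u₂ e₂ k₂) =
    delivery (U₁ ⊕ U₂) (c₁ + c₂)
      (reach-weaken (λ _ → ≤-refl) (λ w → ≤-reflexive (*-distribʳ-+ (δ p w) a b)) (reach-⊕ r₁ r₂))
      (λ w → ≤-trans (+-mono-≤ (u₁ w) (u₂ w)) (l w))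
      (trans (size-⊕ U₁ U₂) (trans (cong₂ _+_ e₁ e₂) (interchange c₁ a c₂ b)))
      (begin
        size (U₁ ⊕ U₂) ≡⟨ size-⊕ U₁ U₂ ⟩
        size U₁ + size U₂
          ≤⟨ +-mono-≤ (≤-trans k₁ (*-monoʳ-≤ a (^-monoʳ-≤ 2 l₁))) (≤-trans k₂ (*-monoʳ-≤ b (^-monoʳ-≤ 2 l₂))) ⟩
        a * 2 ^ h + b * 2 ^ h ≡⟨ *-distribʳ-+ (2 ^ h) a b ⟨
        (a + b) * 2 ^ h ∎)
    where
    open ≤-Reasoning

  on-vertex : ∀ {C : Config n} {k x} → k ≤ C x → Delivery (λ w → C w * δ x w) x k 0
  on-vertex {C} {k} {x} h = delivery (k ⊙ δ x) 0 reach-refl (k⊙δ≤ {C = C} h) (size-k⊙δ k x)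
    (≤-reflexive (trans (size-k⊙δ k x) (sym (*-identityʳ k))))

  along-edge : ∀ {C x p k h} → E T x p → Delivery C x (2 * k) h → Delivery C p k (suc h)
  along-edge {k = k} {h} e (delivery U c r u eq ch) = delivery U (c + k) (reach-trans r (reach-edge* k e)) u
    (trans eq (lem c k)) (≤-trans ch (≤-reflexive (lem₂ k (2 ^ h))))
    where
    lem : ∀ c k → c + 2 * k ≡ c + k + k
    lem = solve-∀
    lem₂ : ∀ k H → 2 * k * H ≡ k * (2 * H)
    lem₂ = solve-∀

  module _ (C : Config n) where

    -- Weighting by multiplicity makes restriction additive over branches, so their deliveries
    -- combine. In `solve`, spanning turns all weights into 1.
    _↾_ : Config n → Forest n → Config n
    (C ↾ F) w = C w * cnt F w

    deliver : ∀ p F → (∀ {a b} → Par p F a b → E T a b) → ∀ k → k ≤ inc C F → Delivery (C ↾ F) p k (ht F)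
    deliver-val : ∀ p F → (∀ {a b} → Par p F a b → E T a b) → ∀ k → k ≤ val C p F →
                  Delivery (λ w → C w * occ p F w) p k (ht F)
    deliver-val p F so k k≤ with split-≤ k (C p) k≤
    ... | a , b , refl , a≤ , b≤ = delivery-⊕ z≤n ≤-refl (λ w → ≤-reflexive (sym (*-distribˡ-+ (C w) (δ p w) _)))
      (on-vertex {C} a≤) (deliver p F so b b≤)
    deliver p nil so zero z≤n =
      delivery (λ _ → 0) 0 (λ X B h → B , done , h) (λ w → z≤n) (size-0 n) (≤-reflexive (size-0 n))
    deliver p (node x ks ss) so k k≤ with split-≤ k ⌊ val C x ks /2⌋ k≤
    ... | a , b , refl , a≤ , b≤ = delivery-⊕ (m≤m⊔n (suc (ht ks)) (ht ss)) (m≤n⊔m (suc (ht ks)) (ht ss))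
      (λ w → ≤-reflexive (sym (*-distribˡ-+ (C w) (δ x w + cnt ks w) _)))
      (along-edge (E-sym T (so top))
        (deliver-val x ks (λ e → so (kid e)) (2 * a) (≤-trans (*-monoʳ-≤ 2 a≤) (2*⌊n/2⌋≤n _))))
      (deliver p ss (λ e → so (sib e)) b b≤)

  -- Rootings of the tree, eccentricity, and the rooted pebbling number

  record Rooting (r : Fin n) (F : Forest n) : Set where
    field
      spans    : Spans r F
      sound    : ∀ {a b} → Par r F a b → E T a b
      complete : ∀ {a b} → E T a b → Par r F a b ⊎ Par r F b a

  module _ {r : Fin n} {F : Forest n} (R : Rooting r F) where
    open Rooting R

    distinct : Distinct r F
    distinct w = ≤-reflexive (spans w)

    depth : Config n
    depth = proj₁ (grade r F 0 distinct)

    depth-root : depth r ≡ 0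
    depth-root = proj₁ (proj₂ (grade r F 0 distinct))

    depth-child : ∀ {a b} → Par r F a b → depth b ≡ suc (depth a)
    depth-child = proj₂ (proj₂ (grade r F 0 distinct))

    -- Every edge joins consecutive levels, so each step of a walk descends at most one level.
    depth-walk : ∀ {u w k} → Walk T u w k → depth w ≤ k + depth u
    depth-walk here = ≤-refl
    depth-walk (step {u} {x} {w} {k} e p) with depth-walk p | complete e
    ... | h | inj₁ c rewrite depth-child c = ≤-trans h (≤-reflexive (+-suc k (depth u)))
    ... | h | inj₂ c rewrite depth-child c = ≤-trans h (≤-trans (+-monoʳ-≤ k (n≤1+n (depth x))) (n≤1+n _))

    deepest : ∀ p F′ → (∀ {a b} → Par p F′ a b → Par r F a b) →
              ∃ λ w → depth w ≡ ht F′ + depth p × Walk T p w (ht F′)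
    deepest p nil h = p , refl , here
    deepest p (node x ks ss) h
      with deepest x ks (λ e → h (kid e)) | deepest p ss (λ e → h (sib e)) | ≤-total (ht ss) (suc (ht ks))
    ... | w , d , q | _ | inj₁ l rewrite m≥n⇒m⊔n≡m l =
      w , trans d (trans (cong (ht ks +_) (depth-child (h top))) (+-suc _ _)) , step (sound (h top)) q
    ... | _ | w , d , q | inj₂ l rewrite m≤n⇒m⊔n≡n l = w , d , q

    -- `IsEcc` bounds distances only. The walk to a deepest vertex realises one, since by
    -- `depth-walk` no shorter walk reaches that level.
    ht≤ecc : ∀ {e} → IsEcc T r e → ht F ≤ e
    ht≤ecc (far , _) with deepest r F (λ e → e)
    ... | w , d , q = far w (ht F) (q , λ k p → begin
      ht F ≡⟨ +-identityʳ (ht F) ⟨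
      ht F + 0 ≡⟨ cong (ht F +_) depth-root ⟨
      ht F + depth r ≡⟨ d ⟨
      depth w ≤⟨ depth-walk p ⟩
      k + depth r ≡⟨ cong (k +_) depth-root ⟩
      k + 0 ≡⟨ +-identityʳ k ⟩
      k ∎)
      where open ≤-Reasoning

    not-both : ∀ {a b} → Par r F a b → Par r F b a → ⊥
    not-both {a} {b} c c′ with depth-child c | depth-child c′
    ... | h | h′ = <-asym (≤-reflexive (sym h)) (≤-reflexive (sym h′))

    solve : ∀ C k → k ≤ val C r F → Delivery C r k (ht F)
    solve C k h with deliver-val C r F sound k h
    ... | delivery U c q u e ch = delivery U c q
      (λ w → ≤-trans (u w) (≤-reflexive (trans (cong (C w *_) (spans w)) (*-identityʳ (C w))))) e ch

    reach-solves : ∀ {C U c k} → Reach U (k ⊙ δ r) c → U ≤ᶜ C → ∃ λ C′ → Steps T C C′ c × k ≤ C′ r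
    reach-solves {C} {U} {k = k} q u with q (λ _ → 0) C (λ w → ≤-trans (≤-reflexive (+-identityʳ (U w))) (u w))
    ... | C′ , s , h = C′ , s ,
      ≤-trans (≤-reflexive (sym (trans (+-identityʳ _) (trans (cong (k *_) (δ-refl r)) (*-identityʳ k))))) (h r)

    -- One pebble beyond `W F + k * H` forces the value above `k`. Conversely, the configuration
    -- from `bad`, cut down to any smaller size, has value at most `k`; the value never grows and
    -- dominates the pebbles on `r`.
    isPiRoot : ∀ k → IsPiRoot T (suc k) r (suc (W F + k * 2 ^ ht F))
    isPiRoot k = enough , least
      where
      H = 2 ^ ht F
      enough : ∀ C → size C ≡ suc (W F + k * H) → Solvable T (suc k) r C
      enough C eq with solve C (suc k) (*-cancelʳ-< H k (val C r F) (+-cancelˡ-< (W F) (k * H) (val C r F * H) (begin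
            suc (W F + k * H) ≡⟨ eq ⟨
            size C ≤⟨ m≤m+n _ _ ⟩
            -- No empty leaves are marked here: the plain estimate is already sharp.
            size C + ΣF (λ _ → 0) F
              ≤⟨ upper-val C (λ _ → 0) (Par r F) (λ _ → z≤n) (λ _ _ → refl) (λ _ _ → refl) spans (λ e → e) ⟩
            val C r F * H + W F ≡⟨ +-comm _ (W F) ⟩
            W F + val C r F * H ∎)))
        where open ≤-Reasoning
      ... | delivery U c q u _ _ with reach-solves q u
      ...   | C′ , s , h = C′ , c , s , h
      least : ∀ m′ → (∀ C → size C ≡ m′ → Solvable T (suc k) r C) → suc (W F + k * H) ≤ m′
      least m′ all with suc (W F + k * H) ≤? m′
      ... | yes h = h
      ... | no h with bad r F k distinct
      ...   | B , _ , vB , sB with shrink B m′ (≤-trans (s≤s⁻¹ (≰⇒> h)) sB)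
      ...     | D , D≤ , refl with all D refl
      ...       | D′ , c , s , t≤ = ⊥-elim (<⇒≱ (s≤s (≤-trans (val-mono r F (λ w _ → D≤ w)) vB))
                    (≤-trans (≤-trans t≤ (m≤m+n (D′ r) (inc D′ F))) (steps-val spans complete s)))

    piBound : ∀ {k P} → IsPi T (suc k) P → suc (W F + k * 2 ^ ht F) ≤ P
    piBound {k} (max , _) = max r _ (isPiRoot k)

  -- Existence of rootings: simple paths and spanning growth

  data Path (R : Fin n → Fin n → Set) (w : Fin n) : Fin n → List (Fin n) → Set where
    stop : Path R w w []
    cons : ∀ {u x xs} → R u x → u ∉ x ∷ xs → Path R w x xs → Path R w u (x ∷ xs)

  module _ {R : Fin n → Fin n → Set} where

    suffix : ∀ {v u w xs} → v ∈ u ∷ xs → Path R w u xs → ∃ (Path R w v)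
    suffix (here refl) p = _ , p
    suffix (there v∈) (cons _ _ p) = suffix v∈ p

    loop-erase : ∀ {u w} → Star R u w → ∃ (Path R w u)
    loop-erase ε = [] , stop
    loop-erase {u} (_◅_ {j = x} r s) with loop-erase s
    ... | xs , p with u ∈? x ∷ xs
    ...   | yes u∈ = suffix u∈ p
    ...   | no u∉ = x ∷ xs , cons r u∉ p

    path-unique : ∀ {u w xs} → Path R w u xs → Unique (u ∷ xs)
    path-unique stop = [] ∷ []
    path-unique (cons {xs = xs} _ u∉ p) = ¬Any⇒All¬ _ u∉ ∷ path-unique p

    path-chain : (∀ {a b} → R a b → E T a b) → ∀ {u w xs y} → E T w y → Path R w u xs → Chain T (u ∷ xs ++ [ y ])
    path-chain f e stop = e ∷ [-]
    path-chain f e (cons r _ stop) = f r ∷ e ∷ [-]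
    path-chain f e (cons r _ p@(cons _ _ _)) = f r ∷ path-chain f e p

    -- A loop-erased R-path with two or more steps would close up with the edge to a cycle.
    acyclic-edge : Acyclic T → (∀ {a b} → R a b → E T a b) → ∀ {u w} → Star R u w → E T u w → R u w
    acyclic-edge acyc f s e with loop-erase s
    ... | [] , stop = ⊥-elim (E-irrefl T e)
    ... | _ , cons r _ stop = r
    ... | xs , p@(cons _ _ (cons _ _ _)) =
      ⊥-elim (acyc (_ , xs , s≤s (s≤s z≤n) , path-unique p , path-chain f (E-sym T e) p))

  Grown : Fin n → Forest n → Set
  Grown r F = Distinct r F × (∀ {a b} → Par r F a b → E T a b)

  -- The walk is followed from a vertex already in the tree, and each new vertex is hung below its
  -- predecessor.
  absorb : ∀ {r u w k} → Walk T u w k → ∀ F → Grown r F → 1 ≤ occ r F u →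
           ∃ λ F′ → Grown r F′ × (∀ z → 1 ≤ occ r F z → 1 ≤ occ r F′ z) × 1 ≤ occ r F′ w
  absorb here F g i = F , g , (λ z h → h) , i
  absorb {r} {u} (step {x = x} e p) F (dis , so) i with 1 ≤? occ r F x
  ... | yes ix = absorb p F (dis , so) ix
  ... | no ¬ix with insert u x r F i
  ...   | F₁ , c , q with absorb p F₁ (dis₁ , so₁)
      (subst (1 ≤_) (sym (occ₁ x)) (≤-trans (≤-reflexive (sym (δ-refl x))) (m≤m+n _ _)))
    where
    occ₁ : ∀ z → occ r F₁ z ≡ δ x z + occ r F z
    occ₁ z = trans (cong (δ r z +_) (c z)) (x∙yz≈y∙xz (δ r z) (δ x z) (cnt F z))
    dis₁ : Distinct r F₁
    dis₁ z with z ≟ x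
    ... | yes refl = ≤-reflexive (trans (occ₁ x) (cong₂ _+_ (δ-refl x) (n<1⇒n≡0 (≰⇒> ¬ix))))
    ... | no z≢x = ≤-trans (≤-reflexive (trans (occ₁ z) (cong (_+ occ r F z) (δ-≢ z≢x)))) (dis z)
    so₁ : ∀ {a b} → Par r F₁ a b → E T a b
    so₁ h with q h
    ... | inj₁ (refl , refl) = e
    ... | inj₂ h′ = so h′
  ...     | F′ , g , m , j = F′ , g , (λ z h → m z (subst (1 ≤_)
      (sym (trans (cong (δ r z +_) (c z)) (x∙yz≈y∙xz (δ r z) (δ x z) (cnt F z)))) (≤-trans h (m≤n+m _ (δ x z))))) , j

  absorb-all : Connected T → ∀ r (l : List (Fin n)) →
               ∃ λ F → Grown r F × (∀ z → z ∈ l → 1 ≤ occ r F z)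
  absorb-all con r [] = nil , ((λ w → ≤-trans (≤-reflexive (+-identityʳ _)) (δ≤1 r w)) , λ ()) , λ z ()
  absorb-all con r (x ∷ l) with absorb-all con r l
  ... | F , g , all with absorb (proj₂ (con r x)) F g (occ-top r F)
  ...   | F′ , g′ , m , i = F′ , g′ , λ { z (here refl) → i ; z (there z∈) → m z (all z z∈) }

  rooting : IsTree T → ∀ r → ∃ (Rooting r)
  rooting (con , acyc) r with absorb-all con r (allFin n)
  ... | F , (dis , so) , all = F , record
    { spans = λ w → ≤-antisym (dis w) (occurs w)
    ; sound = so
    -- Tree edges connect `a` to `b` through the root, so by acyclicity an edge from `a` to `b` must
    -- itself be a tree edge in one of the two directions.
    ; complete = λ {a} {b} → acyclic-edge acyc [ so , (λ e → E-sym T (so e)) ]′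
        (reverse swap (from-root a) ◅◅ from-root b)
    }
    where
    occurs : ∀ w → 1 ≤ occ r F w
    occurs w = all w (∈-allFin w)
    from-root : ∀ w → Star (λ a b → Par r F a b ⊎ Par r F b a) r w
    from-root w = occ⇒star r F inj₁ w (occurs w)

  -- Changing the root

  rooting-map : ∀ {r F r′ F′} → (∀ w → occ r′ F′ w ≡ occ r F w) →
                (∀ {a b} → Par r F a b → Par r′ F′ a b ⊎ Par r′ F′ b a) →
                (∀ {a b} → Par r′ F′ a b → Par r F a b ⊎ Par r F b a) →
                Rooting r F → Rooting r′ F′
  rooting-map o f g R = record
    { spans = λ w → trans (o w) (spans w)
    ; sound = λ e → [ sound , (λ e′ → E-sym T (sound e′)) ]′ (g e)
    ; complete = λ e → [ f , (λ p → swap (f p)) ]′ (complete e)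
    }
    where open Rooting R

  -- The root crosses the edge to its first child: only this edge is reversed, and `v` keeps its
  -- other branches.
  rotate : ∀ {v x ks ss} → Rooting v (node x ks ss) → Rooting x (node v ss ks)
  rotate {v} {x} {ks} {ss} = rooting-map (λ w → exch (δ x w) (δ v w) (cnt ss w) (cnt ks w))
    (λ { top → inj₂ top ; (kid e) → inj₁ (sib e) ; (sib e) → inj₁ (kid e) })
    (λ { top → inj₂ top ; (kid e) → inj₁ (sib e) ; (sib e) → inj₁ (kid e) })
    where
    exch : ∀ a b c d → a + (b + c + d) ≡ b + (a + d + c)
    exch = solve-∀

  -- Bringing the second child to the front lets `rotate` move the root there as well.
  exchange : ∀ {v x ks y ls ss} → Rooting v (node x ks (node y ls ss)) → Rooting v (node y ls (node x ks ss))
  exchange {v} {x} {ks} {y} {ls} {ss} = rooting-map (λ w → exch (δ v w) (δ x w) (cnt ks w) (δ y w) (cnt ls w) (cnt ss w))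
    (λ { top → inj₁ (sib top) ; (kid e) → inj₁ (sib (kid e)) ; (sib top) → inj₁ top
       ; (sib (kid e)) → inj₁ (kid e) ; (sib (sib e)) → inj₁ (sib (sib e)) })
    (λ { top → inj₁ (sib top) ; (kid e) → inj₁ (sib (kid e)) ; (sib top) → inj₁ top
       ; (sib (kid e)) → inj₁ (kid e) ; (sib (sib e)) → inj₁ (sib (sib e)) })
    where
    exch : ∀ v x k y l s → v + (y + l + (x + k + s)) ≡ v + (x + k + (y + l + s))
    exch = solve-∀

  -- The new root is a neighbour of v outside some deepest branch.
  reroot : ∀ {v x ks y ls ss} → let F = node x ks (node y ls ss) in Rooting v F →
           ∃ λ r → ∃ λ F′ → Rooting r F′ × W F ≤ W F′ × suc (ht F) ≤ ht F′
  reroot {v} {x} {ks} {y} {ls} {ss} R with ≤-total (suc (ht ks)) (ht (node y ls ss))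
  ... | inj₁ h = x , node v rest ks , rotate R
      , (begin
          -- The new root `x` gives up its summand; `v` receives `2 ^ ht rest`, which is at least as
          -- large.
          2 ^ ht ks + W ks + W rest ≤⟨ +-monoˡ-≤ (W rest) (+-monoˡ-≤ (W ks) (^-monoʳ-≤ 2 (<⇒≤ h))) ⟩
          2 ^ ht rest + W ks + W rest ≡⟨ exch (2 ^ ht rest) (W ks) (W rest) ⟩
          2 ^ ht rest + W rest + W ks ∎)
      , ≤-trans (s≤s (≤-reflexive (m≤n⇒m⊔n≡n h))) (m≤m⊔n _ (ht ks))
    where
    open ≤-Reasoning
    rest = node y ls ss
    exch : ∀ a b c → a + b + c ≡ a + c + b
    exch = solve-∀
  ... | inj₂ h = y , node v rest ls , rotate (exchange R)
      , (begin
          2 ^ ht ks + W ks + (2 ^ ht ls + W ls + W ss)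
            ≤⟨ +-monoʳ-≤ (2 ^ ht ks + W ks) (+-monoˡ-≤ (W ss) (+-monoˡ-≤ (W ls) (^-monoʳ-≤ 2 ls≤))) ⟩
          2 ^ ht ks + W ks + (2 ^ ht rest + W ls + W ss)
            ≡⟨ exch (2 ^ ht ks) (W ks) (2 ^ ht rest) (W ls) (W ss) ⟩
          2 ^ ht rest + W rest + W ls ∎)
      , ≤-trans (s≤s (≤-trans (≤-reflexive (m≥n⇒m⊔n≡m h)) (m≤m⊔n _ (ht ss)))) (m≤m⊔n _ (ht ls))
    where
    open ≤-Reasoning
    rest = node x ks ss
    ls≤ : ht ls ≤ ht rest
    ls≤ = ≤-trans (≤-trans (n≤1+n _) (≤-trans (m≤m⊔n (suc (ht ls)) (ht ss)) h)) (m≤m⊔n (suc (ht ks)) (ht ss))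
    exch : ∀ a b c d e → a + b + (c + d + e) ≡ c + (a + b + e) + d
    exch = solve-∀

  root-edge : ∀ {v F a} → Rooting v F → E T v a → Par v F v a
  root-edge {v} {F} R e with Rooting.complete R e
  ... | inj₁ c = c
  ... | inj₂ c = ⊥-elim (<⇒≢ (par-child c)
    (sym (sum≤1 {b = cnt F v} (≤-reflexive (Rooting.spans R v)) (≤-reflexive (sym (δ-refl v))))))

  atMostOne⇒leaf : ∀ {v F} → Rooting v F → atMostOne F ≡ true → ∀ {a b} → E T v a → E T v b → a ≡ b
  atMostOne⇒leaf {F = nil} R eq ea eb with root-edge R ea
  ... | ()
  atMostOne⇒leaf {v} {node x ks nil} R eq ea eb = trans (only (root-edge R ea)) (sym (only (root-edge R eb)))
    where
    only : ∀ {a} → Par v (node x ks nil) v a → a ≡ x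
    only top = refl
    only (kid e) = ⊥-elim (<⇒≢ (occ-top v nil)
      (sym (kids⇒∉sibs v x ks nil v (≤-reflexive (Rooting.spans R v)) (par-parent e))))

  -- Solving the targets one by one

  module Targets (tree : IsTree T) where

    F : Fin n → Forest n
    F v = proj₁ (rooting tree v)

    R : ∀ v → Rooting v (F v)
    R v = proj₂ (rooting tree v)

    leaf : Fin n → Bool
    leaf v = atMostOne (F v)

    H : Fin n → ℕ
    H v = rerootedHt (leaf v) (ht (F v))

    ht≤H : ∀ v → ht (F v) ≤ H v
    ht≤H v with atMostOne (F v)
    ... | true = ≤-refl
    ... | false = n≤1+n _

    cap : Fin n → ℕ
    cap v = 2 ^ H v

    piBoundH : ∀ {k P} → IsPi T (suc k) P → ∀ v → suc (W (F v) + k * cap v) ≤ P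
    piBoundH {k} {P} isPi v = go (F v) (R v)
      where
      go : ∀ F′ → Rooting v F′ → suc (W F′ + k * 2 ^ rerootedHt (atMostOne F′) (ht F′)) ≤ P
      go nil r = piBound r isPi
      go (node _ _ nil) r = piBound r isPi
      go (node _ _ (node _ _ _)) r with reroot r
      ... | v′ , F′ , r′ , W≤ , ht≤ = ≤-trans (s≤s (+-mono-≤ W≤ (*-monoʳ-≤ k (^-monoʳ-≤ 2 ht≤)))) (piBound r′ isPi)

    empties : Config n → Config n
    empties C u = emptyLeaf (leaf u) (C u)

    credits : Config n → Config n → Config n
    credits C D u = credit (D u) (leaf u) (C u)

    -- A leaf has only one neighbour, so its parent and child would coincide, against `not-both`.
    empties-inner : ∀ C v {p u k} → Par v (F v) p u → Par v (F v) u k → empties C u ≡ 0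
    empties-inner C v {p} {u} {k} e e′ with atMostOne (F u) in eq
    ... | false = refl
    ... | true with atMostOne⇒leaf (R u) eq (E-sym T (Rooting.sound (R v) e)) (Rooting.sound (R v) e′)
    ...   | refl = ⊥-elim (not-both (R v) e e′)

    -- The summand cap v occurs on both sides so that the bound is (size D − 1) * cap v without subtraction.
    Ready : Config n → Config n → Set
    Ready C D = ∀ v → 1 ≤ D v → W (F v) + size D * cap v + 2 ≤ size C + size (credits C D) + cap v

    -- With `k + 1` demands, `Ready` leaves `W (F v) + k * cap v + 2` for pebbles and credits
    -- together. Beyond the empty leaves other than `v` there are at most `k + 1` credits, and
    -- `k ≤ k * cap v`.
    ready⇒excess : ∀ {C D} → Ready C D → ∀ v → 1 ≤ D v → suc (W (F v)) ≤ size C + ΣF (empties C) (F v)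
    ready⇒excess {C} {D} ready v Dv with size D in eqD | 2^≡suc (H v) | ready v Dv
    ... | zero | _ | _ = ⊥-elim (<⇒≢ (≤-trans Dv (≤size D v)) (sym eqD))
    ... | suc k | m , eq | r rewrite eq = +-cancelʳ-≤ (suc (k + suc m)) _ _ (begin
      -- Since `cap v = suc m`, the slack given away is `k * m`.
      suc (W (F v)) + suc (k + suc m) ≤⟨ m≤m+n _ (k * m) ⟩
      suc (W (F v)) + suc (k + suc m) + k * m ≡⟨ expand (W (F v)) k m ⟩
      W (F v) + suc k * suc m + 2 ≤⟨ r ⟩
      size C + size (credits C D) + suc m ≤⟨ +-monoˡ-≤ (suc m) (+-monoʳ-≤ (size C) credits≤) ⟩
      size C + (ΣF (empties C) (F v) + suc k) + suc m ≡⟨ regroup (size C) _ k m ⟩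
      size C + ΣF (empties C) (F v) + suc (k + suc m) ∎)
      where
      open ≤-Reasoning
      expand : ∀ w k m → suc w + suc (k + suc m) + k * m ≡ w + suc k * suc m + 2
      expand = solve-∀
      regroup : ∀ c a k m → c + (a + suc k) + suc m ≡ c + a + suc (k + suc m)
      regroup = solve-∀
      credits≤ : size (credits C D) ≤ ΣF (empties C) (F v) + suc k
      credits≤ = begin
        size (credits C D) ≡⟨ size-spans {F = F v} (Rooting.spans (R v)) (credits C D) ⟩
        credits C D v + ΣF (credits C D) (F v)
          -- The credit of the root is charged to its demand, because `upper-val` counts no mark
          -- there.
          ≤⟨ +-mono-≤ (≤-trans (credit≤1 (D v) _ _) Dv) (ΣF-mono (λ u → credit≤ (D u) (leaf u) (C u)) (F v)) ⟩
        D v + ΣF (empties C ⊕ D) (F v) ≡⟨ cong (D v +_) (ΣF-⊕ (empties C) D (F v)) ⟩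
        D v + (ΣF (empties C) (F v) + ΣF D (F v)) ≡⟨ x∙yz≈y∙xz (D v) (ΣF (empties C) (F v)) (ΣF D (F v)) ⟩
        ΣF (empties C) (F v) + (D v + ΣF D (F v))
          ≡⟨ cong (ΣF (empties C) (F v) +_) (trans (sym (size-spans {F = F v} (Rooting.spans (R v)) D)) eqD) ⟩
        ΣF (empties C) (F v) + suc k ∎

    -- A target that holds a pebble is served on the spot. That this uses a single pebble is
    -- recorded for the occupied leaves in `spent`.
    cheap-solve : ∀ {C D} → Ready C D → ∀ v → 1 ≤ D v →
                  Σ (Delivery C v 1 (ht (F v))) λ d → 1 ≤ C v → size (Delivery.used d) ≡ 1
    cheap-solve {C} {D} ready v Dv with 1 ≤? C v
    ... | yes Cv = delivery (1 ⊙ δ v) 0 reach-refl used≤ (size-k⊙δ 1 v)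
        (≤-trans (≤-reflexive (size-k⊙δ 1 v)) (≤-trans (m^n>0 2 (ht (F v))) (≤-reflexive (sym (+-identityʳ _)))))
        , λ _ → size-k⊙δ 1 v
      where
      used≤ : 1 ⊙ δ v ≤ᶜ C
      used≤ w = ≤-trans (k⊙δ≤ {C = C} {1} {v} Cv w)
        (≤-trans (*-monoʳ-≤ (C w) (δ≤1 v w)) (≤-reflexive (*-identityʳ (C w))))
    ... | no ¬Cv = solve (R v) C 1 (positive (val C v (F v)) (≤-trans (ready⇒excess {C} {D} ready v Dv)
          (upper-val C (empties C) (Par v (F v)) (λ u → emptyLeaf≤1 (leaf u) (C u))
            (λ u → emptyLeaf-occupied (leaf u)) (empties-inner C v) (Rooting.spans (R v)) (λ e → e))))
        , λ Cv → ⊥-elim (¬Cv Cv)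
      where
      positive : ∀ m → suc (W (F v)) ≤ m * 2 ^ ht (F v) + W (F v) → 1 ≤ m
      positive zero h = ⊥-elim (<-irrefl refl h)
      positive (suc m) h = s≤s z≤n

    -- Induction on the number of demands, with `Ready` as invariant. Serving a target of least `H`
    -- first gives `cap v ≤ cap v′` for every remaining target `v′`, so the amount `cap v′` freed by
    -- one demand fewer covers the pebbles used.
    solve-all : ∀ t C D → size D ≡ t → Ready C D → ∃ λ c → Reach C D c
    solve-all t C D eq ready with argmin D H
    ... | inj₁ none = 0 , reach-weaken (λ w → z≤n) (λ w → ≤-reflexive (none w)) (reach-refl {λ _ → 0})
    solve-all zero C D eq ready | inj₂ (v , Dv , _) = ⊥-elim (<⇒≢ (≤-trans Dv (≤size D v)) (sym eq))
    solve-all (suc t) C D eq ready | inj₂ (v , Dv , min) with cheap-solve {C} {D} ready v Dv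
    ... | delivery U c q U≤ size-U cheap , one = rest (solve-all t C₁ D₁ size-D₁ ready₁)
      where
      open ≤-Reasoning
      C₁ D₁ : Config n
      C₁ w = C w ∸ U w
      D₁ w = D w ∸ δ v w
      C≡ : ∀ w → U w + C₁ w ≡ C w
      C≡ w = m+[n∸m]≡n (U≤ w)
      δ≤D : ∀ w → δ v w ≤ D w
      δ≤D w with w ≟ v
      ... | yes refl = Dv
      ... | no _ = z≤n
      D≡ : ∀ w → δ v w + D₁ w ≡ D w
      D≡ w = m+[n∸m]≡n (δ≤D w)
      size-D : size D ≡ suc (size D₁)
      size-D = trans (sym (size-cong D≡)) (trans (size-⊕ (δ v) D₁) (cong (_+ size D₁) (size-δ v)))
      size-D₁ : size D₁ ≡ t
      size-D₁ = suc-injective (trans (sym size-D) eq)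
      size-C : size C ≡ size U + size C₁
      size-C = trans (sym (size-cong C≡)) (size-⊕ U C₁)
      J J₁ : Config n
      J = credits C D
      J₁ = credits C₁ D₁
      U≤H : size U ≤ cap v
      U≤H = ≤-trans cheap (≤-trans (≤-reflexive (+-identityʳ _)) (^-monoʳ-≤ 2 (ht≤H v)))
      at-v : ∀ (X Y : Config n) → X v ≤ Y v → (∀ u → u ≢ v → X u ≤ Y u) → X ≤ᶜ Y
      at-v X Y here≤ off≤ u with u ≟ v
      ... | yes refl = here≤
      ... | no u≢v = off≤ u u≢v
      -- Away from `v` demands stay and pebbles only disappear, so no credit is lost.
      keep : ∀ u → u ≢ v → J u ≤ J₁ u
      keep u u≢v rewrite δ-≢ {x = v} {u} u≢v = credit-anti (D u) (leaf u) (m∸n≤m (C u) (U u))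

      -- Solving v may destroy the credit of v, and then one pebble must be saved: an occupied leaf is
      -- solved by a single pebble, and at an inner vertex cap v exceeds the cost bound.
      spent : ∀ v′ → 1 ≤ D₁ v′ → cap v ≤ cap v′ → size U + size J ≤ size J₁ + cap v′
      spent v′ D₁v′ E≤ with 1 ≤? J₁ v
      ... | yes J₁v = begin
        size U + size J ≤⟨ +-mono-≤ (≤-trans U≤H E≤) (size-mono J≤J₁) ⟩
        cap v′ + size J₁ ≡⟨ +-comm (cap v′) _ ⟩
        size J₁ + cap v′ ∎
        where
        J≤J₁ : J ≤ᶜ J₁
        J≤J₁ = at-v J J₁ (≤-trans (credit≤1 (D v) (leaf v) (C v)) J₁v) keep
      ... | no ¬J₁v = begin
        size U + size J
          ≤⟨ +-monoʳ-≤ (size U) (≤-trans (size-mono J≤J₁) (≤-reflexive (trans (size-⊕ (δ v) J₁) (cong (_+ size J₁) (size-δ v))))) ⟩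
        size U + (1 + size J₁) ≡⟨ +-suc (size U) (size J₁) ⟩
        suc (size U) + size J₁ ≤⟨ +-monoˡ-≤ (size J₁) (≤-trans (spare (leaf v) refl) E≤) ⟩
        cap v′ + size J₁ ≡⟨ +-comm (cap v′) _ ⟩
        size J₁ + cap v′ ∎
        where
        J≤J₁ : J ≤ᶜ (δ v ⊕ J₁)
        J≤J₁ = at-v J (δ v ⊕ J₁)
          (≤-trans (credit≤1 (D v) (leaf v) (C v)) (≤-trans (≤-reflexive (sym (δ-refl v))) (m≤m+n _ (J₁ v))))
          (λ u u≢v → ≤-trans (keep u u≢v) (m≤n+m _ (δ v u)))
        v′≢v : v′ ≢ v
        v′≢v refl = ¬J₁v (≤-reflexive (sym (credit-demand (leaf v) (C₁ v) D₁v′)))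
        -- A leaf left without credit cannot be empty; it therefore also held a pebble before, and
        -- `one` applies.
        C₁v : leaf v ≡ true → 1 ≤ C₁ v
        C₁v l with 1 ≤? C₁ v
        ... | yes h = h
        ... | no ¬h = ⊥-elim (¬J₁v (≤-trans (≤-reflexive (sym (cong₂ emptyLeaf l (n<1⇒n≡0 (≰⇒> ¬h)))))
          (emptyLeaf≤credit (D₁ v) (leaf v) (C₁ v))))
        spare : ∀ l → leaf v ≡ l → suc (size U) ≤ cap v
        spare false l = ≤-trans (s≤s (≤-trans cheap (≤-reflexive (+-identityʳ _))))
          (≤-trans (^-monoʳ-< 2 (s≤s (s≤s z≤n)) (n<1+n (ht (F v))))
            (≤-reflexive (cong (λ b → 2 ^ rerootedHt b (ht (F v))) (sym l))))
        -- The tree has a second vertex `v′`, so `cap v` is at least 2 while only one pebble is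
        -- used.
        spare true l = ≤-trans (≤-reflexive (cong suc (one (≤-trans (C₁v l) (m∸n≤m (C v) (U v))))))
          (^-monoʳ-≤ 2 (≤-trans (0<ht {F = F v} (Rooting.spans (R v)) v′≢v) (ht≤H v)))

      ready₁ : Ready C₁ D₁
      -- The old invariant and `spent` are added, and the common terms are cancelled in place of a
      -- subtraction.
      ready₁ v′ D₁v′ = +-cancelˡ-≤ (size U + size J + cap v′) _ _ (begin
        size U + size J + cap v′ + (W (F v′) + size D₁ * cap v′ + 2)
          ≡⟨ assemble (size U + size J) (cap v′) (W (F v′)) (size D₁) ⟩
        size U + size J + (W (F v′) + suc (size D₁) * cap v′ + 2)
          ≤⟨ +-mono-≤ (spent v′ D₁v′ (^-monoʳ-≤ 2 (min v′ Dv′)))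
                      (subst (λ m → W (F v′) + m * cap v′ + 2 ≤ size C + size J + cap v′) size-D (ready v′ Dv′)) ⟩
        size J₁ + cap v′ + (size C + size J + cap v′)
          ≡⟨ cong (λ m → size J₁ + cap v′ + (m + size J + cap v′)) size-C ⟩
        size J₁ + cap v′ + (size U + size C₁ + size J + cap v′)
          ≡⟨ regroup (size J₁) (cap v′) (size U) (size C₁) (size J) ⟩
        size U + size J + cap v′ + (size C₁ + size J₁ + cap v′) ∎)
        where
        Dv′ : 1 ≤ D v′
        Dv′ = ≤-trans D₁v′ (m∸n≤m (D v′) (δ v v′))
        assemble : ∀ a e w d → a + e + (w + d * e + 2) ≡ a + (w + suc d * e + 2)
        assemble = solve-∀
        regroup : ∀ j e u c i → j + e + (u + c + i + e) ≡ u + i + e + (c + j + e)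
        regroup = solve-∀

      rest : (∃ λ c → Reach C₁ D₁ c) → ∃ λ c → Reach C D c
      rest (c₁ , q₁) = c + c₁ , reach-weaken (λ w → ≤-reflexive (C≡ w))
        (λ w → ≤-reflexive (trans (sym (D≡ w)) (cong (_+ D₁ w) (sym (*-identityˡ (δ v w)))))) (reach-⊕ q q₁)

    initially-ready : ∀ {P D} → IsPi T (size D) P → 1 ≤ size D → ∀ C → P ∸ support D + 1 ≤ size C → Ready C D
    initially-ready {P} {D} isPi 1≤t C C≥ v Dv with size D in eq
    initially-ready {P} {D} isPi () C C≥ v Dv | zero
    ... | suc k = begin
      W (F v) + suc k * cap v + 2 ≡⟨ peel (W (F v)) k (cap v) ⟩
      suc (W (F v) + k * cap v) + (1 + cap v) ≤⟨ +-monoˡ-≤ _ (piBoundH isPi v) ⟩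
      -- Every target carries a credit at the start, which makes up for the subtracted `support D`.
      P + (1 + cap v) ≤⟨ +-monoˡ-≤ _ (≤-trans (m≤n+m∸n P (support D)) (+-monoˡ-≤ _
                          (support≤size D (credits C D) λ u Du → ≤-reflexive (sym (credit-demand (leaf u) (C u) Du))))) ⟩
      size (credits C D) + (P ∸ support D) + (1 + cap v) ≡⟨ regroup (size (credits C D)) _ (cap v) ⟩
      P ∸ support D + 1 + size (credits C D) + cap v ≤⟨ +-monoˡ-≤ (cap v) (+-monoˡ-≤ _ C≥) ⟩
      size C + size (credits C D) + cap v ∎
      where
      open ≤-Reasoning
      peel : ∀ w k e → w + suc k * e + 2 ≡ suc (w + k * e) + (1 + e)
      peel = solve-∀
      regroup : ∀ j p e → j + p + (1 + e) ≡ p + 1 + j + e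
      regroup = solve-∀

theorem4 : ∀ {n} (T : Graph n) → IsTree T →
    ∀ (D : Config n) (t : ℕ) → size D ≡ t → 1 ≤ t →
    ∀ (P : ℕ) → IsPi T t P →
    (∀ p → IsPiD T D p → p ≤ P ∸ support D + 1)
    × (∀ C → P ∸ support D + 1 ≤ size C →
    ∀ v → 0 < D v → ∀ e → IsEcc T v e → SolvesWithCost T C v (2 ^ e))
theorem4 {n} T tree D _ refl 1≤t P isPi = (λ p (_ , least) → least _ D-solvable) , cheaply
  where
  open Targets T tree
  D-solvable : ∀ C → P ∸ support D + 1 ≤ size C → DSolvable T D C
  D-solvable C C≥ with solve-all (size D) C D refl (initially-ready isPi 1≤t C C≥)
  ... | c , q with q (λ _ → 0) C (λ w → ≤-reflexive (+-identityʳ (C w)))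
  ...   | C′ , s , h = C′ , c , s , λ w → ≤-trans (m≤m+n (D w) 0) (h w)
  cheaply : ∀ C → P ∸ support D + 1 ≤ size C → ∀ v → 0 < D v → ∀ e → IsEcc T v e → SolvesWithCost T C v (2 ^ e)
  cheaply C C≥ v Dv e ecc with cheap-solve {C} {D} (initially-ready isPi 1≤t C C≥) v Dv
  ... | delivery U c q U≤ size-U cheap , _ with reach-solves T (R v) q U≤
  ...   | C′ , s , h = C′ , c , s , h , (begin
    -- One pebble is delivered, so the cost `c + 1` is the number of pebbles used.
    suc c ≡⟨ +-comm 1 c ⟩
    c + 1 ≡⟨ size-U ⟨
    size U ≤⟨ cheap ⟩
    1 * 2 ^ ht (F v) ≡⟨ *-identityˡ (2 ^ ht (F v)) ⟩
    2 ^ ht (F v) ≤⟨ ^-monoʳ-≤ 2 (ht≤ecc T (R v) ecc) ⟩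
    2 ^ e ∎)
    where open ≤-Reasoning
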